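{- For every non-trivial simple connected graph $G=(V,E)$ of order $n$ (so $n\ge 2$) and diameter $d$ such that $\dim(G)<f'(n,d)$, $$\dim_{ms}(G)>\dim(G).$$
   Context: For positive integers $n,d$, $f'(n,d)$ denotes the smallest positive integer $k'$ such that $k'+\binom{k'+d-1}{d-1}\ge n$. Graphs are finite, simple and connected; $d_G(u,v)$ is the length of a shortest $u$–$v$ path. For $S=\{w_1,\ldots,w_t\}\subseteq V$ and $u\in V$, the multiset representation of $u$ with respect to $S$ is the multiset $\operatorname{m}(u|S)$ consisting of $d_G(u,w_1),\ldots,d_G(u,w_t)$, counted with multiplicity, and the metric representation of $u$ (with $S$ ordered) is the vector $\operatorname{r}(u|S)=(d_G(u,w_1),\ldots,d_G(u,w_t))$. A set $S$ is an outer multiset resolving set if $\operatorname{m}(u|S)\ne \operatorname{m}(v|S)$ for every two distinct $u,v\in V\setminus S$; the outer multiset dimension $\dim_{ms}(G)$ is the minimum cardinality of such a set. A set $S$ is a resolving set if $\operatorname{r}(u|S)\neq \operatorname{r}(v|S)$ for every two distinct $u,v\in V$; the metric dimension $\dim(G)$ is the minimum cardinality of a resolving set. -}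

module Defs where

open import Level using (0ℓ)
open import Data.Empty using (⊥-elim)
open import Data.Fin using (Fin)
import Data.Fin.Properties as Fin
open import Data.Fin.Subset using (Subset; _∈_; _∉_; ∣_∣; ⊤)
open import Data.Fin.Subset.Properties using (_∈?_; ∈⊤; anySubset?)
open import Data.List using (List; []; _∷_; map; filter; allFin; cartesianProductWith)
open import Data.List.Extrema.Nat using (max)
open import Data.List.Properties using (≡-dec; ∷-injective)
open import Data.List.Membership.Propositional using () renaming (_∈_ to _∈ˡ_)
open import Data.List.Membership.Propositional.Properties using (∈-allFin; ∈-filter⁺)
open import Data.List.Relation.Unary.Any using (here; there)
open import Data.List.Relation.Binary.Permutation.Propositional
  using (_↭_; ↭-sym; ↭-trans; ↭-reflexive; ↭⇒↭ₛ)
open import Data.List.Relation.Binary.Pointwise using (Pointwise-≡⇒≡)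
open import Data.List.Relation.Unary.Sorted.TotalOrder.Properties using (↗↭↗⇒≋)
open import Data.Nat using (ℕ; zero; suc; _+_; _∸_; _≤_; _<_; _≥_; z≤n; s≤s; _≟_; _≤?_)
open import Data.Nat.Combinatorics using (_C_)
open import Data.Nat.Induction using (<-rec)
open import Data.Nat.Properties
  using (≤-totalOrder; ≤-decTotalOrder; anyUpTo?; ≮⇒≥; n≤1+n; m≤n⇒m≤n+o; n≤0⇒n≡0)
open import Data.List.Sort ≤-decTotalOrder using (sort; sort-↭; sort-↗)
open import Data.Product using (∃; ∃-syntax; _×_; _,_; proj₁; proj₂)
open import Data.Vec using (Vec; []; _∷_; head; last)
open import Data.Vec.Relation.Unary.Linked using (Linked; [-]; linked?)
open import Data.Vec.Relation.Unary.AllPairs using ([]; _∷_; allPairs?)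
open import Data.Vec.Relation.Unary.All using ([])
open import Data.Vec.Relation.Unary.Unique.Propositional using (Unique)
open import Relation.Binary using (Rel; Symmetric; Irreflexive) renaming (Decidable to Decidable₂)
open import Relation.Binary.PropositionalEquality
  using (_≡_; _≢_; refl; sym; trans; subst)
open import Relation.Nullary using (¬_; Dec; yes; no; ¬?; _×-dec_; _→-dec_)
open import Relation.Nullary.Decidable using (map′)
open import Relation.Unary using (Pred; Decidable)

IsLeast : Pred ℕ 0ℓ → ℕ → Set
IsLeast P k = P k × (∀ j → P j → k ≤ j)

leastWitness : ∀ {P : Pred ℕ 0ℓ} → Decidable P → ∃ P → ∃ (IsLeast P)
leastWitness {P} P? (m , Pm) = <-rec (λ k → P k → ∃ (IsLeast P)) step m Pm
  where
  step : ∀ k → (∀ {j} → j < k → P j → ∃ (IsLeast P)) → P k → ∃ (IsLeast P)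
  step k rec Pk with anyUpTo? P? k
  ... | yes (j , j<k , Pj) = rec j<k Pj
  ... | no none            = k , Pk , λ j Pj → ≮⇒≥ λ j<k → none (j , j<k , Pj)

least : ∀ {P : Pred ℕ 0ℓ} → Decidable P → ∃ P → ℕ
least P? wit = proj₁ (leastWitness P? wit)

least-isLeast : ∀ {P : Pred ℕ 0ℓ} (P? : Decidable P) (wit : ∃ P) → IsLeast P (least P? wit)
least-isLeast P? wit = proj₂ (leastWitness P? wit)

-- Truncated subtraction is harmless, since only k ≥ 1 and d ≥ 1 matter:
-- f' n d is meaningful for positive n and d only.
f'-Condition : ℕ → ℕ → Pred ℕ 0ℓ
f'-Condition n d k = 1 ≤ k × k + ((k + d ∸ 1) C (d ∸ 1)) ≥ n

f'-condition? : ∀ n d → Decidable (f'-Condition n d)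
f'-condition? n d k = (1 ≤? k) ×-dec (n ≤? k + ((k + d ∸ 1) C (d ∸ 1)))

f'-condition-holds : ∀ n d → ∃ (f'-Condition n d)
f'-condition-holds n d = suc n , s≤s z≤n , m≤n⇒m≤n+o _ (n≤1+n n)

f' : ℕ → ℕ → ℕ
f' n d = least (f'-condition? n d) (f'-condition-holds n d)

record Graph (n : ℕ) : Set₁ where
  field
    Adj    : Rel (Fin n) 0ℓ
    adj?   : Decidable₂ Adj
    symm   : Symmetric Adj
    irrefl : Irreflexive _≡_ Adj

module _ {n : ℕ} (G : Graph n) where
  open Graph G

  record IsPath (u v : Fin n) {k : ℕ} (xs : Vec (Fin n) (suc k)) : Set where
    field
      starts   : head xs ≡ u
      ends     : last xs ≡ v
      adjacent : Linked Adj xs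
      distinct : Unique xs

  -- Length counts edges, so a path of length k has k + 1 vertices.
  HasPath : Fin n → Fin n → ℕ → Set
  HasPath u v k = ∃[ xs ] IsPath u v {k} xs

  Connected : Set
  Connected = ∀ u v → ∃ (HasPath u v)

anyVec? : ∀ {n} k {P : Pred (Vec (Fin n) k) 0ℓ} → Decidable P → Dec (∃ P)
anyVec? zero    P? = map′ ([] ,_) (λ { ([] , p) → p }) (P? [])
anyVec? (suc k) P? = map′
  (λ { (x , xs , p) → x ∷ xs , p })
  (λ { (x ∷ xs , p) → x , xs , p })
  (Fin.any? λ x → anyVec? k λ xs → P? (x ∷ xs))

isPath? : ∀ {n} (G : Graph n) u v {k} → Decidable (IsPath G u v {k})
isPath? G u v xs = map′
  (λ { (s , e , a , d) → record { starts = s ; ends = e ; adjacent = a ; distinct = d } })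
  (λ p → let open IsPath p in starts , ends , adjacent , distinct)
  ((head xs Fin.≟ u) ×-dec (last xs Fin.≟ v) ×-dec
   linked? (Graph.adj? G) xs ×-dec allPairs? (λ x y → ¬? (x Fin.≟ y)) xs)

hasPath? : ∀ {n} (G : Graph n) u v → Decidable (HasPath G u v)
hasPath? G u v k = anyVec? (suc k) (isPath? G u v)

-- Multisets of naturals are lists up to permutation.
_↭?_ : Decidable₂ (_↭_ {A = ℕ})
xs ↭? ys = map′
  (λ eq → ↭-trans (↭-sym (sort-↭ xs)) (↭-trans (↭-reflexive eq) (sort-↭ ys)))
  (λ p → Pointwise-≡⇒≡ (↗↭↗⇒≋ ≤-totalOrder (sort-↗ xs) (sort-↗ ys)
    (↭⇒↭ₛ (↭-trans (sort-↭ xs) (↭-trans p (↭-sym (sort-↭ ys)))))))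
  (≡-dec _≟_ (sort xs) (sort ys))

-- The elements of S, each once, in increasing order.
elements : ∀ {n} → Subset n → List (Fin n)
elements {n} S = filter (_∈? S) (allFin n)

module _ {n : ℕ} (G : Graph n) (conn : Connected G) where

  dist : Fin n → Fin n → ℕ
  dist u v = least (hasPath? G u v) (conn u v)

  diameter : ℕ
  diameter = max 0 (cartesianProductWith dist (allFin n) (allFin n))

  -- Depending on the equality used on it, this list is the metric
  -- representation r(u|S) (equality _≡_) or the multiset representation
  -- m(u|S) (equality _↭_).
  representation : Fin n → Subset n → List ℕ
  representation u S = map (dist u) (elements S)

  IsResolving : Pred (Subset n) 0ℓ
  IsResolving S = ∀ u v → u ≢ v → representation u S ≢ representation v S

  IsOuterMultisetResolving : Pred (Subset n) 0ℓ
  IsOuterMultisetResolving S = ∀ u v → u ∉ S → v ∉ S → u ≢ v →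
    ¬ (representation u S ↭ representation v S)

  isResolving? : Decidable IsResolving
  isResolving? S = Fin.all? λ u → Fin.all? λ v →
    ¬? (u Fin.≟ v) →-dec ¬? (≡-dec _≟_ (representation u S) (representation v S))

  isOuterMultisetResolving? : Decidable IsOuterMultisetResolving
  isOuterMultisetResolving? S = Fin.all? λ u → Fin.all? λ v →
    ¬? (u ∈? S) →-dec ¬? (v ∈? S) →-dec ¬? (u Fin.≟ v) →-dec
    ¬? (representation u S ↭? representation v S)

  dist-refl : ∀ v → dist v v ≡ 0
  dist-refl v = n≤0⇒n≡0 (proj₂ (least-isLeast (hasPath? G v v) (conn v v)) 0
    (v ∷ [] , record { starts = refl ; ends = refl ; adjacent = [-] ; distinct = [] ∷ [] }))

  hasPath-0⇒≡ : ∀ {u v} → HasPath G u v 0 → u ≡ v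
  hasPath-0⇒≡ (x ∷ [] , p) = trans (sym (IsPath.starts p)) (IsPath.ends p)

  dist≡0⇒≡ : ∀ {u v} → dist u v ≡ 0 → u ≡ v
  dist≡0⇒≡ {u} {v} eq = hasPath-0⇒≡
    (subst (HasPath G u v) eq (proj₁ (least-isLeast (hasPath? G u v) (conn u v))))

  ⊤-isResolving : IsResolving ⊤
  ⊤-isResolving u v u≢v eq = u≢v (dist≡0⇒≡ (trans
    (pointwise (elements ⊤) eq (∈-filter⁺ (_∈? ⊤) (∈-allFin v) ∈⊤)) (dist-refl v)))
    where
    pointwise : ∀ ws → map (dist u) ws ≡ map (dist v) ws → ∀ {w} → w ∈ˡ ws → dist u w ≡ dist v w
    pointwise (w ∷ ws) eq (here refl) = proj₁ (∷-injective eq)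
    pointwise (w ∷ ws) eq (there w∈)  = pointwise ws (proj₂ (∷-injective eq)) w∈

  ⊤-isOuterMultisetResolving : IsOuterMultisetResolving ⊤
  ⊤-isOuterMultisetResolving u v u∉⊤ = ⊥-elim (u∉⊤ ∈⊤)

HasCardinality : ∀ {n} → Pred (Subset n) 0ℓ → Pred ℕ 0ℓ
HasCardinality Q k = ∃[ S ] Q S × ∣ S ∣ ≡ k

minCardinality : ∀ {n} {Q : Pred (Subset n) 0ℓ} → Decidable Q → ∃ Q → ℕ
minCardinality {Q = Q} Q? (S , QS) =
  least {HasCardinality Q} (λ k → anySubset? λ T → Q? T ×-dec (∣ T ∣ ≟ k)) (∣ S ∣ , S , QS , refl)

module _ {n : ℕ} (G : Graph n) (conn : Connected G) where

  dim : ℕ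
  dim = minCardinality (isResolving? G conn) (⊤ , ⊤-isResolving G conn)

  dimₘₛ : ℕ
  dimₘₛ = minCardinality (isOuterMultisetResolving? G conn) (⊤ , ⊤-isOuterMultisetResolving G conn)

{-# OPTIONS --safe #-}
module Submission where

-- Let S be an outer multiset resolving set of size k.  The vertices outside S
-- have pairwise distinct multiset representations, each a multiset of size k
-- over {1, …, d}, so n ≤ k + C(k + d − 1, d − 1), that is, f'(n, d) ≤ k.  Hence
-- f'(n, d) ≤ dimₘₛ G always holds, and dim G < f'(n, d) forces dim G < dimₘₛ G.

open import Defs
open import Data.Fin using (Fin; zero; suc; join; splitAt)
open import Data.Fin.Properties using (_≟_; injective⇒≤; splitAt-join)
open import Data.Fin.Subset using (Subset; inside; outside; _∈_; _∉_; ∣_∣; ⊤)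
open import Data.Fin.Subset.Properties using (_∈?_; anySubset?; drop-there)
open import Data.List
  using (List; []; _∷_; [_]; _++_; length; map; filter; replicate; tabulate; allFin)
open import Data.List.Extrema.Nat using (xs≤max)
open import Data.List.Membership.Propositional using () renaming (_∈_ to _∈ˡ_)
open import Data.List.Membership.Propositional.Properties
  using (∈-allFin; ∈-filter⁺; ∈-∃++; ∈-map⁺; ∈-++⁺ˡ; ∈-++⁺ʳ; ∈-cartesianProductWith⁺)
open import Data.List.Membership.Setoid.Properties using (index-injective)
open import Data.List.Properties using (length-++; length-map; filter-accept; filter-reject)
open import Data.List.Relation.Binary.Permutation.Propositional
  using (_↭_; ↭-refl; ↭-reflexive; ↭-sym; ↭-trans; prep)
open import Data.List.Relation.Binary.Permutation.Propositional.Properties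
  using (All-resp-↭; ↭-length; shift)
open import Data.List.Relation.Unary.All as All using (All; []; _∷_)
import Data.List.Relation.Unary.All.Properties as All
open import Data.List.Relation.Unary.Any using (here; index)
open import Data.Nat using (ℕ; zero; suc; _+_; _∸_; _≤_; _≥_; _<_; _>_; s≤s)
open import Data.Nat.Combinatorics using (_C_; nCn≡1; nCk+nC[k+1]≡[n+1]C[k+1])
import Data.Nat.Properties as ℕ
open import Data.Nat.Properties
  using (≤-trans; ≤-antisym; ≤-reflexive; <-≤-trans; ≤⇒≯; ≤-pred; m≤n⇒m<n∨m≡n; n≢0⇒n>0;
         suc-injective; +-suc; +-comm)
open import Data.List.Membership.DecPropositional ℕ._≟_ using () renaming (_∈?_ to _∈ˡ?_)
open import Data.Product using (∃; ∃-syntax; _×_; _,_; proj₁; proj₂)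
open import Data.Sum using (_⊎_; inj₁; inj₂)
open import Data.Sum.Properties using (inj₁-injective; inj₂-injective)
open import Data.Vec using ([]; _∷_; here; there)
open import Function using (_∘_; id; Injective)
open import Level using (0ℓ)
open import Relation.Binary.PropositionalEquality
  using (_≡_; _≢_; refl; sym; trans; cong; cong₂; subst; setoid; module ≡-Reasoning)
open import Relation.Nullary using (Dec; yes; no; contradiction; _×-dec_)
open import Relation.Nullary.Decidable using (decidable-stable)
open import Relation.Unary using (Pred; Decidable)

InRange : ℕ → ℕ → Set
InRange d x = 1 ≤ x × x ≤ d

-- One list per multiset of size k over {1, …, suc e}, largest element first.
multisets : ℕ → ℕ → List (List ℕ)
multisets zero    k       = [ replicate k 1 ]
multisets (suc e) zero    = [ [] ]
multisets (suc e) (suc k) = map (suc (suc e) ∷_) (multisets (suc e) k) ++ multisets e (suc k)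

-- Stars and bars by Pascal's rule: the two pieces of `multisets`, with and without the top value,
-- count the two summands. The base cases have one multiset each.
length-multisets : ∀ e k → length (multisets e k) ≡ (k + e) C e
length-multisets zero    k       = refl
length-multisets (suc e) zero    = sym (nCn≡1 (suc e))
length-multisets (suc e) (suc k) = begin
  length (map (suc (suc e) ∷_) (multisets (suc e) k) ++ multisets e (suc k))
    ≡⟨ length-++ (map (suc (suc e) ∷_) (multisets (suc e) k)) ⟩
  length (map (suc (suc e) ∷_) (multisets (suc e) k)) + length (multisets e (suc k))
    ≡⟨ cong₂ _+_ (trans (length-map _ (multisets (suc e) k)) (length-multisets (suc e) k))
                 (length-multisets e (suc k)) ⟩
  (k + suc e) C suc e + suc (k + e) C e
    ≡⟨ cong (λ m → (k + suc e) C suc e + m C e) (+-suc k e) ⟨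
  (k + suc e) C suc e + (k + suc e) C e
    ≡⟨ +-comm ((k + suc e) C suc e) _ ⟩
  (k + suc e) C e + (k + suc e) C suc e
    ≡⟨ nCk+nC[k+1]≡[n+1]C[k+1] (k + suc e) e ⟩
  suc (k + suc e) C suc e
    ∎
  where open ≡-Reasoning

all-1⇒replicate : ∀ {xs} → All (InRange 1) xs → xs ≡ replicate (length xs) 1
all-1⇒replicate []                      = refl
all-1⇒replicate ((1≤x , x≤1) ∷ inRange) = cong₂ _∷_ (≤-antisym x≤1 1≤x) (all-1⇒replicate inRange)

-- The induction asks whether the largest allowed value occurs in `xs`. If it does, one copy is
-- permuted to the front and `k` drops; if not, every entry obeys the smaller bound and `e` drops.
multisets-complete : ∀ e k {xs} → length xs ≡ k → All (InRange (suc e)) xs →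
  ∃[ ys ] ys ∈ˡ multisets e k × xs ↭ ys
multisets-complete zero    k    refl inRange = _ , here refl , ↭-reflexive (all-1⇒replicate inRange)
multisets-complete (suc e) zero {[]} _ _     = [] , here refl , ↭-refl
multisets-complete (suc e) (suc k) {xs} len inRange with suc (suc e) ∈ˡ? xs
... | yes top∈xs =
  let ps , qs , xs≡      = ∈-∃++ top∈xs
      xs↭                = ↭-trans (↭-reflexive xs≡) (shift _ ps qs)
      ys , ys∈ , rest↭ys = multisets-complete (suc e) k
                             (suc-injective (trans (sym (↭-length xs↭)) len))
                             (All.tail (All-resp-↭ xs↭ inRange))
  in _ , ∈-++⁺ˡ (∈-map⁺ _ ys∈) , ↭-trans xs↭ (prep _ rest↭ys)
... | no top∉xs =
  let ys , ys∈ , xs↭ys = multisets-complete e (suc k) len (All.tabulate below)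
  in ys , ∈-++⁺ʳ _ ys∈ , xs↭ys
  where
  below : ∀ {x} → x ∈ˡ xs → InRange (suc e) x
  below x∈xs with All.lookup inRange x∈xs
  ... | 1≤x , x≤top with m≤n⇒m<n∨m≡n x≤top
  ...   | inj₁ x<top = 1≤x , ≤-pred x<top
  ...   | inj₂ refl  = contradiction x∈xs top∉xs

-- Generalises the case `f = id`, `T = S` so that induction can shrink `T`, the preimage of `S`
-- under `f`, while the filter predicate stays fixed.
length-filter-tabulate : ∀ {m n} (S : Subset n) (T : Subset m) (f : Fin m → Fin n) →
  (∀ {i} → i ∈ T → f i ∈ S) → (∀ {i} → f i ∈ S → i ∈ T) →
  length (filter (_∈? S) (tabulate f)) ≡ ∣ T ∣
length-filter-tabulate S []            f to from = refl
length-filter-tabulate S (inside ∷ T)  f to from = trans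
  (cong length (filter-accept (_∈? S) (to here)))
  (cong suc (length-filter-tabulate S T (f ∘ suc) (to ∘ there) (drop-there ∘ from)))
length-filter-tabulate S (outside ∷ T) f to from = trans
  (cong length (filter-reject (_∈? S) λ f0∈S → zero∉ (from f0∈S)))
  (length-filter-tabulate S T (f ∘ suc) (to ∘ there) (drop-there ∘ from))
  where
  zero∉ : zero ∉ outside ∷ T
  zero∉ ()

length-elements : ∀ {n} (S : Subset n) → length (elements S) ≡ ∣ S ∣
length-elements S = length-filter-tabulate S S id id id

minCardinality-attained : ∀ {n} {Q : Pred (Subset n) 0ℓ} (Q? : Decidable Q) (wit : ∃ Q) →
  HasCardinality Q (minCardinality Q? wit)
minCardinality-attained {Q = Q} Q? (S , QS) = proj₁ (least-isLeast {HasCardinality Q}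
  (λ k → anySubset? λ T → Q? T ×-dec (∣ T ∣ ℕ.≟ k)) (∣ S ∣ , S , QS , refl))

f'-minimal : ∀ n d {k} → f'-Condition n d k → f' n d ≤ k
f'-minimal n d = proj₂ (least-isLeast (f'-condition? n d) (f'-condition-holds n d)) _

module _ {n : ℕ} (G : Graph n) (conn : Connected G) where

  dist≤diameter : ∀ u v → dist G conn u v ≤ diameter G conn
  dist≤diameter u v = All.lookup (xs≤max 0 _)
    (∈-cartesianProductWith⁺ (dist G conn) (∈-allFin u) (∈-allFin v))

  ≢⇒dist-inRange : ∀ {u v} → u ≢ v → InRange (diameter G conn) (dist G conn u v)
  ≢⇒dist-inRange u≢v = n≢0⇒n>0 (u≢v ∘ dist≡0⇒≡ G conn) , dist≤diameter _ _

  -- A vertex outside `S` differs from each element of `S`, so the distance 0 never occurs. This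
  -- leaves only `diameter` many possible values, as the binomial coefficient in `f'` demands.
  representation-inRange : ∀ {u S} → u ∉ S →
    All (InRange (diameter G conn)) (representation G conn u S)
  representation-inRange {u} {S} u∉S = All.map⁺ (All.map
    (λ w∈S → ≢⇒dist-inRange λ { refl → u∉S w∈S })
    (All.all-filter (_∈? S) (allFin n)))

  length-representation : ∀ u S → length (representation G conn u S) ≡ ∣ S ∣
  length-representation u S = trans (length-map _ (elements S)) (length-elements S)

  -- Counting by an injection: vertices in `S` go to their position in `elements S`, the others to
  -- the position of their multiset in `multisets e ∣ S ∣`.
  order≤ : ∀ {e} → diameter G conn ≡ suc e → ∀ S → IsOuterMultisetResolving G conn S →
    n ≤ ∣ S ∣ + (∣ S ∣ + e) C e
  order≤ {e} diam S resolving = subst (n ≤_)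
    (cong₂ _+_ (length-elements S) (length-multisets e ∣ S ∣))
    (injective⇒≤ {f = λ u → join _ _ (slot u (u ∈? S))} λ {u} {v} eq →
      slot-injective (u ∈? S) (v ∈? S) (join-injective eq))
    where
    code : ∀ {u} → u ∉ S → ∃[ ys ] ys ∈ˡ multisets e ∣ S ∣ × representation G conn u S ↭ ys
    code {u} u∉S = multisets-complete e ∣ S ∣ (length-representation u S)
      (subst (λ d → All (InRange d) (representation G conn u S)) diam (representation-inRange u∉S))

    -- The decision is an explicit argument so that the injectivity proof can match on it directly.
    slot : ∀ u → Dec (u ∈ S) → Fin (length (elements S)) ⊎ Fin (length (multisets e ∣ S ∣))
    slot u (yes u∈S) = inj₁ (index (∈-filter⁺ (_∈? S) (∈-allFin u) u∈S))
    slot u (no u∉S)  = inj₂ (index (proj₁ (proj₂ (code u∉S))))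

    slot-injective : ∀ {u v} (u? : Dec (u ∈ S)) (v? : Dec (v ∈ S)) → slot u u? ≡ slot v v? → u ≡ v
    slot-injective (yes _) (yes _) eq = index-injective (setoid _) _ _ (inj₁-injective eq)
    slot-injective {u} {v} (no u∉S) (no v∉S) eq =
      let ys , ys∈ , u↭ys = code u∉S
          zs , zs∈ , v↭zs = code v∉S
          ys≡zs           = index-injective (setoid _) ys∈ zs∈ (inj₂-injective eq)
      -- Equal positions give a common listed multiset, hence permuted representations. Since
      -- `resolving` only refutes `u ≢ v`, decidable equality recovers `u ≡ v`.
      in decidable-stable (u ≟ v) λ u≢v → resolving u v u∉S v∉S u≢v
           (↭-trans u↭ys (↭-trans (↭-reflexive ys≡zs) (↭-sym v↭zs)))

    join-injective : ∀ {a b} → Injective _≡_ _≡_ (join a b)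
    join-injective {a} {b} {i} {j} eq =
      trans (sym (splitAt-join a b i)) (trans (cong (splitAt a) eq) (splitAt-join a b j))

  diameter-positive : n ≥ 2 → 1 ≤ diameter G conn
  diameter-positive (s≤s (s≤s _)) =
    let 1≤dist , dist≤diam = ≢⇒dist-inRange {zero} {suc zero} λ ()
    in ≤-trans 1≤dist dist≤diam

  f'-condition-∣S∣ : n ≥ 2 → ∀ S → IsOuterMultisetResolving G conn S →
    f'-Condition n (diameter G conn) ∣ S ∣
  f'-condition-∣S∣ n≥2 S resolving with diameter G conn in diam | diameter-positive n≥2
  -- Diameter 0 is excluded by `diameter-positive`; writing the diameter as `suc e` lets `d ∸ 1`
  -- compute to `e`.
  ... | suc e | _ =
    n≢0⇒n>0 nonempty ,
    -- The upper index in `f'-Condition` is `∣ S ∣ + suc e ∸ 1`, while `bound` has `∣ S ∣ + e`.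
    subst (λ m → n ≤ ∣ S ∣ + m C e) (sym (cong (_∸ 1) (+-suc ∣ S ∣ e))) bound
    where
    bound : n ≤ ∣ S ∣ + (∣ S ∣ + e) C e
    bound = order≤ diam S resolving

    -- For an empty `S` the bound collapses to `n ≤ e C e`, which is 1, against `n ≥ 2`.
    nonempty : ∣ S ∣ ≢ 0
    nonempty empty = contradiction n≥2 (≤⇒≯
      (≤-trans bound (≤-reflexive (trans (cong (λ k → k + (k + e) C e) empty) (nCn≡1 e)))))

  f'≤dimₘₛ : n ≥ 2 → f' n (diameter G conn) ≤ dimₘₛ G conn
  f'≤dimₘₛ n≥2 =
    let S , resolving , ∣S∣≡ = minCardinality-attained
          (isOuterMultisetResolving? G conn) (⊤ , ⊤-isOuterMultisetResolving G conn)
    in subst (f' n (diameter G conn) ≤_) ∣S∣≡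
         (f'-minimal n (diameter G conn) (f'-condition-∣S∣ n≥2 S resolving))

theorem3p6 : ∀ (n d : ℕ) → n ≥ 2 → (G : Graph n) (conn : Connected G) →
    diameter G conn ≡ d → dim G conn < f' n d → dimₘₛ G conn > dim G conn
theorem3p6 n _ n≥2 G conn refl dim<f' = <-≤-trans dim<f' (f'≤dimₘₛ G conn n≥2)
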